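{- An LCTRS with set of rules $\mathcal{R}$ is terminating (that is, $\to_{\mathcal{R}}$ is terminating) if and only if the set $\mathsf{DP}(\mathcal{R})$ of its dependency pairs is chain-free.
   Context: Terms are many-sorted. Let $\mathcal{V}$ be an infinite set of sorted variables; let $\Sigma=\Sigma_{\mathit{terms}}\cup\Sigma_{\mathit{theory}}$ be a many-sorted signature; let $\mathcal{I}$ assign to each sort $\iota$ occurring in $\Sigma_{\mathit{theory}}$ a set $\mathcal{I}_\iota$; let $\mathcal{J}$ map each $f:[\iota_1\times\cdots\times\iota_n]\Rightarrow\kappa$ in $\Sigma_{\mathit{theory}}$ to a function $\mathcal{J}_f$ from $\mathcal{I}_{\iota_1},\ldots,\mathcal{I}_{\iota_n}$ to $\mathcal{I}_\kappa$. For each sort $\iota$ occurring in $\Sigma_{\mathit{theory}}$ fix a set $\mathcal{V}al_\iota\subseteq\Sigma_{\mathit{theory}}$ of values: constants of sort $\iota$ such that $\mathcal{J}$ gives a one-to-one mapping from $\mathcal{V}al_\iota$ to $\mathcal{I}_\iota$ (every element of $\mathcal{I}_\iota$ is represented by a unique value); $\mathcal{V}al$ is the set of all values. $\Sigma_{\mathit{terms}}$ and $\Sigma_{\mathit{theory}}$ overlap only on values. $\mathcal{T}\mathit{erms}(\Sigma',X)$ is the set of well-sorted terms over symbols $\Sigma'$ and variables $X$; $\mathit{Var}(s)$ is the set of variables of $s$. A logical term is an element of $\mathcal{T}\mathit{erms}(\Sigma_{\mathit{theory}},\mathcal{V})$. For ground logical terms, $[\![f(s_1,\ldots,s_n)]\!]:=\mathcal{J}_f([\![s_1]\!],\ldots,[\![s_n]\!])$;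 the value of a ground logical term $s$ is the unique value $t$ with $[\![s]\!]=[\![t]\!]$. A constraint is a logical term of a sort $\mathsf{bool}$ with $\mathcal{I}_{\mathsf{bool}}=\{\top,\bot\}$ (the booleans). A constraint $s$ is valid if $[\![s\gamma]\!]=\top$ for all substitutions $\gamma$ mapping the variables in $\mathit{Var}(s)$ to values. A rule is a triple $l\to r\,[\varphi]$ where $l,r$ are terms of the same sort, $\varphi$ is a constraint, and $l$ is not a logical term (so also not a variable). $\mathit{LVar}(l\to r\,[\varphi]):=\mathit{Var}(\varphi)\cup(\mathit{Var}(r)\setminus\mathit{Var}(l))$. A substitution $\gamma$ respects $l\to r\,[\varphi]$ if $\gamma(x)$ is a value for all $x\in\mathit{LVar}(l\to r\,[\varphi])$ and $\varphi\gamma$ is valid. An LCTRS is given by such a setting with a set $\mathcal{R}$ of rules; $\to_{\mathcal{R}}$ is the union of $\to_{\mathtt{rule}}$ and $\to_{\mathtt{calc}}$, where $C[l\gamma]\to_{\mathtt{rule}}C[r\gamma]$ if $l\to r\,[\varphi]\in\mathcal{R}$ and $\gamma$ respects $l\to r\,[\varphi]$; and $C[f(s_1,\ldots,s_n)]\to_{\mathtt{calc}}C[v]$ if $f\in\Sigma_{\mathit{theory}}\setminus\Sigma_{\mathit{terms}}$, all $s_i$ are values and $v$ is the value of $f(s_1,\ldots,s_n)$. Defined symbols are all symbols $f$ such that $\mathcal{R}$ contains a rule of the form $f(\vec{l})\to r\,[\varphi]$. Dependency pairs: introduce a fresh sort $\mathsf{dpsort}$ and, for each defined symbol $f:[\iota_1\times\cdots\times\iota_n]\Rightarrow\kappa$,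 a new symbol $f^\sharp:[\iota_1\times\cdots\times\iota_n]\Rightarrow\mathsf{dpsort}$. If $s=f(s_1,\ldots,s_n)$ with $f$ defined, then $s^\sharp:=f^\sharp(s_1,\ldots,s_n)$. The dependency pairs of a rule $l\to r\,[\varphi]$ are all rules $l^\sharp\to p^\sharp\,[\varphi]$ where $p$ is a subterm of $r$ headed by a defined symbol. $\mathsf{DP}(\mathcal{R})$ is the set of all dependency pairs of rules in $\mathcal{R}$. Given a set $\mathcal{P}$ of dependency pairs, a $\mathcal{P}$-chain is a sequence $\rho_1,\rho_2,\ldots$ of elements of $\mathcal{P}$, each with distinctly renamed variables, such that there is a substitution $\gamma$ which respects all $\rho_i$ and such that for all $i$: if $\rho_i=l_i\to p_i\,[\varphi_i]$ and $\rho_{i+1}=l_{i+1}\to p_{i+1}\,[\varphi_{i+1}]$, then $p_i\gamma\to_{\mathcal{R}}^* l_{i+1}\gamma$; moreover the strict subterms of each $l_i\gamma$ are terminating with respect to $\to_{\mathcal{R}}$. (The single substitution $\gamma$ may have infinite domain.) $\mathcal{P}$ is chain-free if there is no infinite $\mathcal{P}$-chain.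
   Formalization: Added assumptions: every variable of a rule's right-hand side that is absent from its left-hand side has a sort with at least one value (else f(x) → g(f(x),y) is a counterexample), and there are infinitely many variables of each sort, as renaming apart requires. -}

module Defs where

open import Data.Bool.Base using (Bool; true)
open import Data.Empty using (⊥)
open import Data.List.Base using (List; []; _∷_; map)
open import Data.List.Relation.Unary.All as All using (All; []; _∷_)
open import Data.List.Relation.Unary.All.Properties using (map⁻)
open import Data.Maybe.Base using (Maybe; just; nothing)
open import Data.Nat.Base using (ℕ; suc)
open import Data.Product.Base using (_×_; _,_; proj₁; proj₂; ∃-syntax)
open import Data.Sum.Base using (_⊎_; inj₁; inj₂)
open import Function.Base using (_∘_; _∋_; flip)
open import Function.Bundles using (_↣_; _⤖_; _↔_; Bijection; Inverse)
open import Function.Construct.Identity using (↣-id)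
open import Induction.InfiniteDescent using (InfiniteDescendingSequenceFrom)
open import Relation.Binary.Construct.Closure.ReflexiveTransitive using (Star)
open import Relation.Binary.PropositionalEquality.Core using (_≡_; _≢_; refl)
open import Relation.Nullary.Negation.Core using (¬_)

-- Σ-terms = TermSym ⊎ Val and Σ-theory = TheorySym ⊎ Val, so that the two
-- signatures overlap exactly on the values.  For a sort that does not occur
-- in Σ-theory there are no values, and I is taken to be empty there.
record Setting : Set₁ where
  field
    Sort      : Set
    Var       : Sort → Set
    TermSym   : List Sort → Sort → Set
    TheorySym : List Sort → Sort → Set
    Val       : Sort → Set
    I         : Sort → Set
    J         : ∀ {δ κ} → TheorySym δ κ → All I δ → I κ
    J-val     : ∀ {ι} → Val ι ⤖ I ι
    bool      : Sort
    I-bool    : I bool ↔ Bool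
    -- Infinitely many variables of each sort, as needed for renaming apart
    -- the members of an infinite sequence of rules.
    infinite  : ∀ ι → ℕ ↣ Var ι

  ⟦_⟧ᵥ : ∀ {ι} → Val ι → I ι
  ⟦_⟧ᵥ = Bijection.to J-val

  ⊤ᴵ : I bool
  ⊤ᴵ = Inverse.from I-bool true

------------------------------------------------------------------------
-- Terms, rules and rewriting over a fixed setting

module _ (S : Setting) where
  open Setting S

  data Sym : List Sort → Sort → Set where
    term   : ∀ {δ κ} → TermSym δ κ → Sym δ κ
    theory : ∀ {δ κ} → TheorySym δ κ → Sym δ κ
    val    : ∀ {κ} → Val κ → Sym [] κ

  data Term : Sort → Set where
    var : ∀ {κ} → Var κ → Term κ
    con : ∀ {δ κ} → Sym δ κ → All Term δ → Term κ

module _ {S : Setting} where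
  open Setting S

  ⌞_⌟ : ∀ {κ} → Val κ → Term S κ
  ⌞ v ⌟ = con (val v) []

  IsValue : ∀ {κ} → Term S κ → Set
  IsValue t = ∃[ v ] t ≡ ⌞ v ⌟

  Subst : Set
  Subst = ∀ {κ} → Var κ → Term S κ

  infixl 8 _[_] _[_]*

  mutual
    _[_] : ∀ {κ} → Term S κ → Subst → Term S κ
    var x    [ γ ] = γ x
    con f ts [ γ ] = con f (ts [ γ ]*)

    _[_]* : ∀ {δ} → All (Term S) δ → Subst → All (Term S) δ
    []       [ γ ]* = []
    (t ∷ ts) [ γ ]* = t [ γ ] ∷ ts [ γ ]*

  infix 4 _⊴_ _◁_ _⊴*_ _∈Var_

  -- Subterm, strict subterm, subterm of some member of a list of arguments.
  mutual
    data _⊴_ {ι} (s : Term S ι) : ∀ {κ} → Term S κ → Set where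
      self   : s ⊴ s
      strict : ∀ {κ} {t : Term S κ} → s ◁ t → s ⊴ t

    data _◁_ {ι} (s : Term S ι) : ∀ {κ} → Term S κ → Set where
      arg : ∀ {δ κ} {f : Sym S δ κ} {ts} → s ⊴* ts → s ◁ con f ts

    data _⊴*_ {ι} (s : Term S ι) : ∀ {δ} → All (Term S) δ → Set where
      here  : ∀ {κ δ} {t : Term S κ} {ts : All (Term S) δ} →
              s ⊴ t → s ⊴* (t ∷ ts)
      there : ∀ {κ δ} {t : Term S κ} {ts : All (Term S) δ} →
              s ⊴* ts → s ⊴* (t ∷ ts)

  _∈Var_ : ∀ {ι κ} → Var ι → Term S κ → Set
  x ∈Var t = var x ⊴ t

  mutual
    data Logical : ∀ {κ} → Term S κ → Set where
      var    : ∀ {κ} {x : Var κ} → Logical (var x)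
      theory : ∀ {δ κ} {f : TheorySym δ κ} {ts} →
               Logicals ts → Logical (con (theory f) ts)
      val    : ∀ {κ} {v : Val κ} → Logical ⌞ v ⌟

    data Logicals : ∀ {δ} → All (Term S) δ → Set where
      []  : Logicals []
      _∷_ : ∀ {κ δ} {t : Term S κ} {ts : All (Term S) δ} →
            Logical t → Logicals ts → Logicals (t ∷ ts)

  infix 4 _⇓_ _⇓*_

  -- t ⇓ a : the term t is ground and logical, and ⟦ t ⟧ = a.
  mutual
    data _⇓_ : ∀ {κ} → Term S κ → I κ → Set where
      theory : ∀ {δ κ} {f : TheorySym δ κ} {ts as} →
               ts ⇓* as → con (theory f) ts ⇓ J f as
      val    : ∀ {κ} {v : Val κ} → ⌞ v ⌟ ⇓ ⟦ v ⟧ᵥ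

    data _⇓*_ : ∀ {δ} → All (Term S) δ → All I δ → Set where
      []  : [] ⇓* []
      _∷_ : ∀ {κ δ} {t : Term S κ} {a} {ts : All (Term S) δ} {as} →
            t ⇓ a → ts ⇓* as → (t ∷ ts) ⇓* (a ∷ as)

  Valid : Term S bool → Set
  Valid φ = Logical φ ×
            ((γ : Subst) → (∀ {ι} {x : Var ι} → x ∈Var φ → IsValue (γ x)) →
             φ [ γ ] ⇓ ⊤ᴵ)

module _ (S : Setting) where
  open Setting S

  record Rule (κ : Sort) : Set where
    field
      lhs rhs        : Term S κ
      constraint     : Term S bool
      logical        : Logical constraint
      lhs-nonlogical : ¬ Logical lhs

  Rules : Set₁
  Rules = ∀ {κ} → Rule κ → Set

module _ {S : Setting} where
  open Setting S
  open Rule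

  _∈LVar_ : ∀ {ι κ} → Var ι → Rule S κ → Set
  x ∈LVar ρ = x ∈Var constraint ρ ⊎ (x ∈Var rhs ρ × ¬ (x ∈Var lhs ρ))

  _∈VarRule_ : ∀ {ι κ} → Var ι → Rule S κ → Set
  x ∈VarRule ρ = x ∈Var lhs ρ ⊎ x ∈Var rhs ρ ⊎ x ∈Var constraint ρ

  _Respects_ : ∀ {κ} → Subst {S} → Rule S κ → Set
  γ Respects ρ = (∀ {ι} {x : Var ι} → x ∈LVar ρ → IsValue (γ x)) ×
                 Valid (constraint ρ [ γ ])

  Renaming : Set
  Renaming = ∀ {ι} → Var ι → Var ι

  asSubst : Renaming → Subst {S}
  asSubst δ x = var (δ x)

  mutual
    logical-rename⁺ : ∀ (δ : Renaming) {κ} {t : Term S κ} →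
                      Logical t → Logical (t [ asSubst δ ])
    logical-rename⁺ δ var         = var
    logical-rename⁺ δ (theory ls) = theory (logicals-rename⁺ δ ls)
    logical-rename⁺ δ val         = val

    logicals-rename⁺ : ∀ (δ : Renaming) {ιs} {ts : All (Term S) ιs} →
                       Logicals ts → Logicals (ts [ asSubst δ ]*)
    logicals-rename⁺ δ []       = []
    logicals-rename⁺ δ (l ∷ ls) = logical-rename⁺ δ l ∷ logicals-rename⁺ δ ls

  mutual
    logical-rename⁻ : ∀ (δ : Renaming) {κ} (t : Term S κ) →
                      Logical (t [ asSubst δ ]) → Logical t
    logical-rename⁻ δ (var x)             _           = var
    logical-rename⁻ δ (con (theory f) ts) (theory ls) =
      theory (logicals-rename⁻ δ ts ls)
    logical-rename⁻ δ (con (val v) [])    _           = val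

    logicals-rename⁻ : ∀ (δ : Renaming) {ιs} (ts : All (Term S) ιs) →
                       Logicals (ts [ asSubst δ ]*) → Logicals ts
    logicals-rename⁻ δ []       _        = []
    logicals-rename⁻ δ (t ∷ ts) (l ∷ ls) =
      logical-rename⁻ δ t l ∷ logicals-rename⁻ δ ts ls

  rename : ∀ {κ} → Renaming → Rule S κ → Rule S κ
  rename δ ρ = record
    { lhs            = lhs ρ [ asSubst δ ]
    ; rhs            = rhs ρ [ asSubst δ ]
    ; constraint     = constraint ρ [ asSubst δ ]
    ; logical        = logical-rename⁺ δ (logical ρ)
    ; lhs-nonlogical = lhs-nonlogical ρ ∘ logical-rename⁻ δ (lhs ρ)
    }

  InjectiveOnVars : ∀ {κ} → Renaming → Rule S κ → Set
  InjectiveOnVars δ ρ = ∀ {ι} {x y : Var ι} →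
    x ∈VarRule ρ → y ∈VarRule ρ → δ x ≡ δ y → x ≡ y

  mutual
    data Context (ι : Sort) : Sort → Set where
      □   : Context ι ι
      con : ∀ {δ κ} → Sym S δ κ → Contexts ι δ → Context ι κ

    -- An argument list with a context in exactly one position.
    data Contexts (ι : Sort) : List Sort → Set where
      here  : ∀ {κ δ} → Context ι κ → All (Term S) δ → Contexts ι (κ ∷ δ)
      there : ∀ {κ δ} → Term S κ → Contexts ι δ → Contexts ι (κ ∷ δ)

  infixl 8 _⟨_⟩ _⟨_⟩*

  mutual
    _⟨_⟩ : ∀ {ι κ} → Context ι κ → Term S ι → Term S κ
    □        ⟨ s ⟩ = s
    con f Cs ⟨ s ⟩ = con f (Cs ⟨ s ⟩*)

    _⟨_⟩* : ∀ {ι δ} → Contexts ι δ → Term S ι → All (Term S) δ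
    here C ts  ⟨ s ⟩* = C ⟨ s ⟩ ∷ ts
    there t Cs ⟨ s ⟩* = t ∷ Cs ⟨ s ⟩*

record LCTRS : Set₁ where
  field
    setting : Setting
    R       : Rules setting
  open Setting setting public

------------------------------------------------------------------------
-- Rewriting, termination and chains

module _ (L : LCTRS) where
  open LCTRS L renaming (setting to S)
  open Rule

  data StepRule {κ} : Term S κ → Term S κ → Set where
    step : ∀ {ι} (C : Context ι κ) {ρ : Rule S ι} → R ρ →
           (γ : Subst) → γ Respects ρ →
           StepRule (C ⟨ lhs ρ [ γ ] ⟩) (C ⟨ rhs ρ [ γ ] ⟩)

  data StepCalc {κ} : Term S κ → Term S κ → Set where
    step : ∀ {δ ι} (C : Context ι κ) (f : TheorySym δ ι)
           (vs : All Val δ) (v : Val ι) →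
           (Term S ι ∋ con (theory f) (All.map ⌞_⌟ vs)) ⇓ ⟦ v ⟧ᵥ →
           StepCalc (C ⟨ con (theory f) (All.map ⌞_⌟ vs) ⟩) (C ⟨ ⌞ v ⌟ ⟩)

  Step : ∀ {κ} → Term S κ → Term S κ → Set
  Step s t = StepRule s t ⊎ StepCalc s t

  TerminatingAt : ∀ {κ} → Term S κ → Set
  TerminatingAt t = ¬ (∃[ s ] InfiniteDescendingSequenceFrom (flip Step) s t)

  Terminating : Set
  Terminating = ∀ {κ} (t : Term S κ) → TerminatingAt t

  record InfiniteChain {κ} (P : Rule S κ → Set) : Set where
    field
      rule       : ℕ → Rule S κ
      rule∈P     : ∀ i → P (rule i)
      δ          : ℕ → Renaming {S}
      injective  : ∀ i → InjectiveOnVars (δ i) (rule i)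

    ρ : ℕ → Rule S κ
    ρ i = rename (δ i) (rule i)

    field
      disjoint   : ∀ {i j} → i ≢ j → ∀ {ι} {x : Var ι} →
                   x ∈VarRule ρ i → ¬ (x ∈VarRule ρ j)
      γ          : Subst {S}
      respects   : ∀ i → γ Respects ρ i
      connected  : ∀ i → Star Step (rhs (ρ i) [ γ ]) (lhs (ρ (suc i)) [ γ ])
      minimal    : ∀ i {ι} {s : Term S ι} →
                   s ◁ lhs (ρ i) [ γ ] → TerminatingAt s

  ChainFree : ∀ {κ} → (Rule S κ → Set) → Set
  ChainFree P = ¬ InfiniteChain P

  data _HeadOf_ {δ κ} (f : Sym S δ κ) : ∀ {ι} → Term S ι → Set where
    head : ∀ {ts} → f HeadOf con f ts

  Defined : ∀ {δ κ} → Sym S δ κ → Set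
  Defined f = ∃[ κ ] ∃[ ρ ] R {κ} ρ × f HeadOf lhs ρ

  RootDefined : ∀ {κ} → Term S κ → Set
  RootDefined (var x)    = ⊥
  RootDefined (con f ts) = Defined f

  -- A variable occurring in the right-hand side of a rule but not in the left
  -- can only be instantiated by values, so its sort should have some.
  FreshVariablesHaveValues : Set
  FreshVariablesHaveValues = ∀ {κ} {ρ : Rule S κ} → R ρ →
    ∀ {ι} {x : Var ι} → x ∈Var rhs ρ → ¬ (x ∈Var lhs ρ) → Val ι

------------------------------------------------------------------------
-- The extension of an LCTRS by a sort dpsort and the symbols f♯

module _ (L : LCTRS) where
  open LCTRS L renaming (setting to S)

  Sort♯ : Set
  Sort♯ = Maybe Sort

  pattern dpsort = nothing

  Var♯ : Sort♯ → Set
  Var♯ (just ι) = Var ι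
  Var♯ dpsort   = ℕ

  -- Irrelevance of the second argument ensures that there is only one symbol
  -- f♯ for each f, even if several rules define f.
  data TermSym♯ : List Sort♯ → Sort♯ → Set where
    old : ∀ {δ κ} → TermSym δ κ → TermSym♯ (map just δ) (just κ)
    _♯  : ∀ {δ κ} (f : Sym S δ κ) → .(Defined L f) → TermSym♯ (map just δ) dpsort

  data TheorySym♯ : List Sort♯ → Sort♯ → Set where
    old : ∀ {δ κ} → TheorySym δ κ → TheorySym♯ (map just δ) (just κ)

  Val♯ : Sort♯ → Set
  Val♯ (just ι) = Val ι
  Val♯ dpsort   = ⊥

  I♯ : Sort♯ → Set
  I♯ (just ι) = I ι
  I♯ dpsort   = ⊥

  J♯ : ∀ {δ κ} → TheorySym♯ δ κ → All I♯ δ → I♯ κ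
  J♯ (old f) as = J f (map⁻ as)

  J-val♯ : ∀ {ι} → Val♯ ι ⤖ I♯ ι
  J-val♯ {just ι} = J-val {ι}
  J-val♯ {dpsort} = record
    { to        = λ ()
    ; cong      = λ { {()} }
    ; bijective = (λ { {()} }) , λ ()
    }

  infinite♯ : ∀ ι → ℕ ↣ Var♯ ι
  infinite♯ (just ι) = infinite ι
  infinite♯ dpsort   = ↣-id ℕ

  setting♯ : Setting
  setting♯ = record
    { Sort      = Sort♯
    ; Var       = Var♯
    ; TermSym   = TermSym♯
    ; TheorySym = TheorySym♯
    ; Val       = Val♯
    ; I         = I♯
    ; J         = J♯
    ; J-val     = λ {ι} → J-val♯ {ι}
    ; bool      = just bool
    ; I-bool    = I-bool
    ; infinite  = infinite♯
    }

  mutual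
    embed : ∀ {κ} → Term S κ → Term setting♯ (just κ)
    embed (var x)             = var x
    embed (con (term f) ts)   = con (term (old f)) (embed* ts)
    embed (con (theory f) ts) = con (theory (old f)) (embed* ts)
    embed (con (val v) [])    = ⌞ v ⌟

    embed* : ∀ {δ} → All (Term S) δ → All (Term setting♯) (map just δ)
    embed* []       = []
    embed* (t ∷ ts) = embed t ∷ embed* ts

  mutual
    logical-embed⁺ : ∀ {κ} {t : Term S κ} → Logical t → Logical (embed t)
    logical-embed⁺ var         = var
    logical-embed⁺ (theory ls) = theory (logicals-embed⁺ ls)
    logical-embed⁺ val         = val

    logicals-embed⁺ : ∀ {δ} {ts : All (Term S) δ} →
                      Logicals ts → Logicals (embed* ts)
    logicals-embed⁺ []       = []
    logicals-embed⁺ (l ∷ ls) = logical-embed⁺ l ∷ logicals-embed⁺ ls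

  mutual
    logical-embed⁻ : ∀ {κ} (t : Term S κ) → Logical (embed t) → Logical t
    logical-embed⁻ (var x)             _           = var
    logical-embed⁻ (con (theory f) ts) (theory ls) =
      theory (logicals-embed⁻ ts ls)
    logical-embed⁻ (con (val v) [])    _           = val

    logicals-embed⁻ : ∀ {δ} (ts : All (Term S) δ) →
                      Logicals (embed* ts) → Logicals ts
    logicals-embed⁻ []       _        = []
    logicals-embed⁻ (t ∷ ts) (l ∷ ls) =
      logical-embed⁻ t l ∷ logicals-embed⁻ ts ls

  embedRule : ∀ {κ} → Rule S κ → Rule setting♯ (just κ)
  embedRule ρ = record
    { lhs            = embed (lhs ρ)
    ; rhs            = embed (rhs ρ)
    ; constraint     = embed (constraint ρ)
    ; logical        = logical-embed⁺ (logical ρ)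
    ; lhs-nonlogical = lhs-nonlogical ρ ∘ logical-embed⁻ (lhs ρ)
    } where open Rule

  data R♯ : ∀ {κ} → Rule setting♯ κ → Set where
    old : ∀ {κ} {ρ : Rule S κ} → R ρ → R♯ (embedRule ρ)

  lctrs♯ : LCTRS
  lctrs♯ = record { setting = setting♯ ; R = R♯ }

  sharp : ∀ {κ} (t : Term S κ) → .(RootDefined L t) → Term setting♯ dpsort
  sharp (con f ts) d = con (term ((f ♯) d)) (embed* ts)

  sharp-nonlogical : ∀ {κ} (t : Term S κ) .(d : RootDefined L t) →
                     ¬ Logical (sharp t d)
  sharp-nonlogical (con f ts) d ()

  lhs-defined : ∀ {κ} {ρ : Rule S κ} → R ρ → RootDefined L (Rule.lhs ρ)
  lhs-defined {κ} {ρ} Rρ =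
    root (Rule.lhs ρ) (Rule.lhs-nonlogical ρ) (λ h → κ , ρ , Rρ , h)
    where
    root : ∀ {κ} (t : Term S κ) → ¬ Logical t →
           (∀ {δ ι} {f : Sym S δ ι} → _HeadOf_ L f t → Defined L f) →
           RootDefined L t
    root (var x)    nl _ with () ← nl var
    root (con f ts) _  d = d head

  data DP : Rule setting♯ dpsort → Set where
    dp : ∀ {κ} {ρ : Rule S κ} (Rρ : R ρ) {ι} {p : Term S ι} →
         p ⊴ Rule.rhs ρ → (d : RootDefined L p) →
         DP (record
           { lhs            = sharp (Rule.lhs ρ) (lhs-defined Rρ)
           ; rhs            = sharp p d
           ; constraint     = embed (Rule.constraint ρ)
           ; logical        = logical-embed⁺ (Rule.logical ρ)
           ; lhs-nonlogical = sharp-nonlogical (Rule.lhs ρ) (lhs-defined Rρ)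
           })

{-# OPTIONS --safe #-}
-- If a chain starts at l₀γ, then each lᵢγ rewrites to a term with the subterm pᵢγ, which rewrites
-- to lᵢ₊₁γ; keeping the surrounding contexts gives an infinite reduction.  Conversely, a term that
-- is non-terminating while its proper subterms terminate can, after reducing its arguments, be
-- rewritten at the root by some rule to a non-terminating rγ; a smallest subterm p of r with pγ
-- non-terminating yields a dependency pair, and pγ is again minimal non-terminating.  The
-- substitutions of the successive pairs are glued into one after renaming the pairs apart.
module Submission where

open import Defs
open import Axiom.ExcludedMiddle using (ExcludedMiddle)
open import Data.Fin.Base using (toℕ)
open import Data.Fin.Properties using (toℕ-injective)
open import Data.List.Base using (List; []; _∷_; _++_; map)
open import Data.List.Membership.Propositional using (_∈_)
open import Data.List.Membership.Propositional.Properties using (∈-++⁺ˡ; ∈-++⁺ʳ)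
open import Data.List.Membership.Setoid.Properties using (index-injective)
open import Data.List.Relation.Unary.All as All using (All; []; _∷_)
open import Data.List.Relation.Unary.All.Properties using (map⁺; map⁻)
open import Data.List.Relation.Unary.Any using (here; index)
open import Data.Maybe.Base using (Maybe; just; nothing)
open import Data.Maybe.Properties using (just-injective)
open import Data.Nat.Base using (ℕ; zero; suc; _*_)
open import Data.Nat.Properties using (even≢odd; *-cancelˡ-≡; suc-injective)
open import Data.Product.Base using (Σ-syntax; _×_; _,_; proj₁; proj₂; ∃-syntax)
open import Data.Sum.Base using (_⊎_; inj₁; inj₂)
open import Function.Base using (_∘_; _∋_; flip)
open import Function.Bundles using (_⇔_; mk⇔; Injection)
open import Induction.InfiniteDescent using (InfiniteDescendingSequenceFrom)
open import Induction.WellFounded using (Acc; acc)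
open import Level using (0ℓ)
open import Relation.Binary.Construct.Closure.ReflexiveTransitive using (Star; ε; _◅_; gmap)
open import Relation.Binary.PropositionalEquality
  using (_≡_; _≢_; refl; sym; trans; cong; cong₂; subst; subst₂; setoid)
open import Relation.Nullary using (¬_; yes; no; contradiction)
open import Relation.Nullary.Decidable using (decidable-stable)

-- An injective pairing of natural numbers.

pair : ℕ → ℕ → ℕ
pair zero    k = suc (2 * k)
pair (suc i) k = 2 * pair i k

-- `pair i k` is 2^i (2k + 1), so parity separates a zero first component from a positive one, and
-- halving handles two positive ones.
pair-injective : ∀ i j {k l} → pair i k ≡ pair j l → i ≡ j × k ≡ l
pair-injective zero    zero    eq = refl , *-cancelˡ-≡ _ _ 2 (suc-injective eq)
pair-injective zero    (suc j) {k} {l} eq = contradiction (sym eq) (even≢odd (pair j l) k)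
pair-injective (suc i) zero    {k} {l} eq = contradiction eq (even≢odd (pair i k) l)
pair-injective (suc i) (suc j) eq =
  let i≡j , k≡l = pair-injective i j (*-cancelˡ-≡ _ _ 2 eq) in cong suc i≡j , k≡l

-- Accessibility and infinite descending sequences.

module _ {A : Set} {_<_ : A → A → Set} where

  acc⇒¬sequence : ∀ {x} → Acc _<_ x → ∀ s → ¬ InfiniteDescendingSequenceFrom _<_ s x
  acc⇒¬sequence (acc rs) s (refl , dec) =
    acc⇒¬sequence (rs (dec 0)) (s ∘ suc) (refl , dec ∘ suc)

  module _ (em : ExcludedMiddle 0ℓ) where

    -- Excluded middle decides every type, so it returns an actual witness. It thereby serves as the
    -- choice function that iterates successors into a sequence.
    ¬acc⇒∃ : ∀ {x} → ¬ Acc _<_ x → ∃[ y ] y < x × ¬ Acc _<_ y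
    ¬acc⇒∃ ¬a = decidable-stable em λ ¬e →
      ¬a (acc λ {y} y<x → decidable-stable em λ ¬b → ¬e (y , y<x , ¬b))

    ¬acc⇒sequence : ∀ {x} → ¬ Acc _<_ x → ∃[ s ] InfiniteDescendingSequenceFrom _<_ s x
    ¬acc⇒sequence {x} ¬a = proj₁ ∘ s , refl , λ n → proj₁ (proj₂ (¬acc⇒∃ (proj₂ (s n))))
      where
      s : ℕ → ∃[ y ] ¬ Acc _<_ y
      s zero    = x , ¬a
      s (suc n) = let y , _ , ¬b = ¬acc⇒∃ (proj₂ (s n)) in y , ¬b

-- Terms and substitutions

module _ {S : Setting} where
  open Setting S

  mutual
    ⊴-trans : ∀ {ι κ μ} {s : Term S ι} {t : Term S κ} {u : Term S μ} →
              s ⊴ t → t ⊴ u → s ⊴ u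
    ⊴-trans p self       = p
    ⊴-trans p (strict q) = strict (⊴-◁-trans p q)

    ⊴-◁-trans : ∀ {ι κ μ} {s : Term S ι} {t : Term S κ} {u : Term S μ} →
                s ⊴ t → t ◁ u → s ◁ u
    ⊴-◁-trans p (arg q) = arg (⊴-⊴*-trans p q)

    ⊴-⊴*-trans : ∀ {ι κ δ} {s : Term S ι} {t : Term S κ} {us : All (Term S) δ} →
                 s ⊴ t → t ⊴* us → s ⊴* us
    ⊴-⊴*-trans p (here q)  = here (⊴-trans p q)
    ⊴-⊴*-trans p (there q) = there (⊴-⊴*-trans p q)

  mutual
    []-⊴⁺ : ∀ {ι κ} {s : Term S ι} {t : Term S κ} (γ : Subst) → s ⊴ t → s [ γ ] ⊴ t [ γ ]
    []-⊴⁺ γ self             = self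
    []-⊴⁺ γ (strict (arg q)) = strict (arg ([]*-⊴*⁺ γ q))

    []*-⊴*⁺ : ∀ {ι δ} {s : Term S ι} {ts : All (Term S) δ} (γ : Subst) →
              s ⊴* ts → s [ γ ] ⊴* ts [ γ ]*
    []*-⊴*⁺ γ (here q)  = here ([]-⊴⁺ γ q)
    []*-⊴*⁺ γ (there q) = there ([]*-⊴*⁺ γ q)

  []*-⊴*⁻ : ∀ {ι δ} {s : Term S ι} (ts : All (Term S) δ) (γ : Subst) → s ⊴* ts [ γ ]* →
            ∃[ κ ] Σ[ t ∈ Term S κ ] t ⊴* ts × s ⊴ t [ γ ]
  []*-⊴*⁻ (t ∷ ts) γ (here q)  = _ , t , here self , q
  []*-⊴*⁻ (t ∷ ts) γ (there q) =
    let κ , u , u⊴ts , s⊴u = []*-⊴*⁻ ts γ q in κ , u , there u⊴ts , s⊴u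

  mutual
    ∈Var-[]⁻ : ∀ {ι κ} {x : Var ι} (t : Term S κ) (γ : Subst) → x ∈Var t [ γ ] →
               ∃[ μ ] Σ[ y ∈ Var μ ] y ∈Var t × x ∈Var γ y
    ∈Var-[]⁻ (var y)    γ p                = _ , y , self , p
    ∈Var-[]⁻ (con f ts) γ (strict (arg q)) =
      let μ , y , y∈ts , p = ∈Var-[]*⁻ ts γ q in μ , y , strict (arg y∈ts) , p

    ∈Var-[]*⁻ : ∀ {ι δ} {x : Var ι} (ts : All (Term S) δ) (γ : Subst) → var x ⊴* ts [ γ ]* →
                ∃[ μ ] Σ[ y ∈ Var μ ] var y ⊴* ts × x ∈Var γ y
    ∈Var-[]*⁻ (t ∷ ts) γ (here q)  =
      let μ , y , y∈t , p = ∈Var-[]⁻ t γ q in μ , y , here y∈t , p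
    ∈Var-[]*⁻ (t ∷ ts) γ (there q) =
      let μ , y , y∈ts , p = ∈Var-[]*⁻ ts γ q in μ , y , there y∈ts , p

  mutual
    []-cong : ∀ {κ} (t : Term S κ) {γ γ′ : Subst} →
              (∀ {ι} {x : Var ι} → x ∈Var t → γ x ≡ γ′ x) → t [ γ ] ≡ t [ γ′ ]
    []-cong (var x)    eq = eq self
    []-cong (con f ts) eq = cong (con f) ([]*-cong ts (eq ∘ strict ∘ arg))

    []*-cong : ∀ {δ} (ts : All (Term S) δ) {γ γ′ : Subst} →
               (∀ {ι} {x : Var ι} → var x ⊴* ts → γ x ≡ γ′ x) → ts [ γ ]* ≡ ts [ γ′ ]*
    []*-cong []       eq = refl
    []*-cong (t ∷ ts) eq = cong₂ _∷_ ([]-cong t (eq ∘ here)) ([]*-cong ts (eq ∘ there))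

  mutual
    []-rename : ∀ {κ} (t : Term S κ) (δ : Renaming {S}) (γ : Subst) →
                t [ asSubst δ ] [ γ ] ≡ t [ (λ x → γ (δ x)) ]
    []-rename (var x)    δ γ = refl
    []-rename (con f ts) δ γ = cong (con f) ([]*-rename ts δ γ)

    []*-rename : ∀ {ιs} (ts : All (Term S) ιs) (δ : Renaming {S}) (γ : Subst) →
                 ts [ asSubst δ ]* [ γ ]* ≡ ts [ (λ x → γ (δ x)) ]*
    []*-rename []       δ γ = refl
    []*-rename (t ∷ ts) δ γ = cong₂ _∷_ ([]-rename t δ γ) ([]*-rename ts δ γ)

  ∈Var-rename⁻ : ∀ {ι κ} {x : Var ι} (t : Term S κ) (δ : Renaming {S}) → x ∈Var t [ asSubst δ ] →
                 ∃[ y ] y ∈Var t × x ≡ δ y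
  ∈Var-rename⁻ t δ p with ∈Var-[]⁻ t (asSubst δ) p
  ... | _ , y , y∈t , self = y , y∈t , refl

  -- Substitution keeps the root symbol, so only a variable or a value can become a value. Hence no
  -- left-hand side matches a value.
  value-[]⁻ : ∀ {κ} (t : Term S κ) {γ : Subst} → IsValue (t [ γ ]) → Logical t
  value-[]⁻ (var x)            _ = var
  value-[]⁻ (con (term f) ts)   (_ , ())
  value-[]⁻ (con (theory f) ts) (_ , ())
  value-[]⁻ (con (val v) [])   _ = val

  var-[]⁻ : ∀ {κ} {x : Var κ} (t : Term S κ) {γ : Subst} → var x ≡ t [ γ ] → Logical t
  var-[]⁻ (var x) _ = var

  mutual
    []-var : ∀ {κ} (t : Term S κ) → t [ var ] ≡ t
    []-var (var x)    = refl
    []-var (con f ts) = cong (con f) ([]*-var ts)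

    []*-var : ∀ {δ} (ts : All (Term S) δ) → ts [ var ]* ≡ ts
    []*-var []       = refl
    []*-var (t ∷ ts) = cong₂ _∷_ ([]-var t) ([]*-var ts)

  -- A non-logical `l` is not a variable, so all its variables lie strictly below the root and are
  -- instantiated inside the arguments.
  instance-var : ∀ {δ κ} {f : Sym S δ κ} {us} {γ : Subst} {l} → ¬ Logical l → con f us ≡ l [ γ ] →
                 ∀ {ι} {x : Var ι} → x ∈Var l → γ x ⊴* us
  instance-var {l = var x}    nl _    _                = contradiction var nl
  instance-var {l = con g ls} _  refl (strict (arg q)) = []*-⊴*⁺ _ q

  open Rule

  module _ {κ} (δ : Renaming {S}) (ρ : Rule S κ) where

    ∈VarRule-rename⁻ : ∀ {ι} {x : Var ι} → x ∈VarRule rename δ ρ →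
                       ∃[ y ] y ∈VarRule ρ × x ≡ δ y
    ∈VarRule-rename⁻ (inj₁ p) =
      let y , q , eq = ∈Var-rename⁻ (lhs ρ) δ p in y , inj₁ q , eq
    ∈VarRule-rename⁻ (inj₂ (inj₁ p)) =
      let y , q , eq = ∈Var-rename⁻ (rhs ρ) δ p in y , inj₂ (inj₁ q) , eq
    ∈VarRule-rename⁻ (inj₂ (inj₂ p)) =
      let y , q , eq = ∈Var-rename⁻ (constraint ρ) δ p in y , inj₂ (inj₂ q) , eq

    respects-rename⁻ : InjectiveOnVars δ ρ → ∀ {γ : Subst} → γ Respects rename δ ρ →
                       (λ x → γ (δ x)) Respects ρ
    respects-rename⁻ inj {γ} (values , valid) =
      values′ , subst Valid ([]-rename (constraint ρ) δ γ) valid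
      where
      values′ : ∀ {ι} {x : Var ι} → x ∈LVar ρ → IsValue (γ (δ x))
      values′ (inj₁ x∈φ)         = values (inj₁ ([]-⊴⁺ (asSubst δ) x∈φ))
      -- Renaming could identify `x` with a variable of the left-hand side and so remove it from
      -- `LVar`; injectivity on the rule excludes this.
      values′ (inj₂ (x∈r , x∉l)) = values (inj₂ ([]-⊴⁺ (asSubst δ) x∈r , λ δx∈l →
        let y , y∈l , eq = ∈Var-rename⁻ (lhs ρ) δ δx∈l in
        x∉l (subst (_∈Var lhs ρ) (sym (inj (inj₂ (inj₁ x∈r)) (inj₁ y∈l) eq)) y∈l)))

    respects-rename⁺ : ∀ {γ : Subst} → (λ x → γ (δ x)) Respects ρ → γ Respects rename δ ρ
    respects-rename⁺ {γ} (values , valid) =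
      values′ , subst Valid (sym ([]-rename (constraint ρ) δ γ)) valid
      where
      values′ : ∀ {ι} {x : Var ι} → x ∈LVar rename δ ρ → IsValue (γ x)
      values′ (inj₁ x∈φ) with ∈Var-rename⁻ (constraint ρ) δ x∈φ
      ... | y , y∈φ , refl = values (inj₁ y∈φ)
      values′ (inj₂ (x∈r , x∉l)) with ∈Var-rename⁻ (rhs ρ) δ x∈r
      ... | y , y∈r , refl = values (inj₂ (y∈r , x∉l ∘ []-⊴⁺ (asSubst δ)))

  respects-cong : ∀ {κ} (ρ : Rule S κ) {γ γ′ : Subst} →
                  (∀ {ι} {x : Var ι} → x ∈VarRule ρ → γ x ≡ γ′ x) →
                  γ Respects ρ → γ′ Respects ρ
  respects-cong ρ {γ} {γ′} eq (values , valid) =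
    values′ , subst Valid ([]-cong (constraint ρ) (eq ∘ inj₂ ∘ inj₂)) valid
    where
    values′ : ∀ {ι} {x : Var ι} → x ∈LVar ρ → IsValue (γ′ x)
    values′ (inj₁ p)        = subst IsValue (eq (inj₂ (inj₂ p))) (values (inj₁ p))
    values′ (inj₂ (p , ¬q)) = subst IsValue (eq (inj₂ (inj₁ p))) (values (inj₂ (p , ¬q)))

  mutual
    vars : ∀ {κ} → Term S κ → List (∃[ ι ] Var ι)
    vars (var x)    = (_ , x) ∷ []
    vars (con f ts) = vars* ts

    vars* : ∀ {δ} → All (Term S) δ → List (∃[ ι ] Var ι)
    vars* []       = []
    vars* (t ∷ ts) = vars t ++ vars* ts

  mutual
    ∈-vars : ∀ {ι κ} {x : Var ι} {t : Term S κ} → x ∈Var t → (ι , x) ∈ vars t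
    ∈-vars self             = here refl
    ∈-vars (strict (arg q)) = ∈-vars* q

    ∈-vars* : ∀ {ι δ} {x : Var ι} {ts : All (Term S) δ} → var x ⊴* ts → (ι , x) ∈ vars* ts
    ∈-vars* (here q)  = ∈-++⁺ˡ (∈-vars q)
    ∈-vars* {ts = t ∷ ts} (there q) = ∈-++⁺ʳ (vars t) (∈-vars* q)

  ruleVars : ∀ {κ} → Rule S κ → List (∃[ ι ] Var ι)
  ruleVars ρ = vars (lhs ρ) ++ vars (rhs ρ) ++ vars (constraint ρ)

  ∈-ruleVars : ∀ {ι κ} {x : Var ι} (ρ : Rule S κ) → x ∈VarRule ρ → (ι , x) ∈ ruleVars ρ
  ∈-ruleVars ρ (inj₁ p)        = ∈-++⁺ˡ (∈-vars p)
  ∈-ruleVars ρ (inj₂ (inj₁ p)) = ∈-++⁺ʳ (vars (lhs ρ)) (∈-++⁺ˡ (∈-vars p))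
  ∈-ruleVars ρ (inj₂ (inj₂ p)) =
    ∈-++⁺ʳ (vars (lhs ρ)) (∈-++⁺ʳ (vars (rhs ρ)) (∈-vars p))

-- Renaming apart

module _ (em : ExcludedMiddle 0ℓ) {S : Setting} {κ} (rule : ℕ → Rule S κ) where
  open Setting S

  -- The k-th variable of the i-th rule becomes the variable number pair i k of its sort.
  apart : ℕ → Renaming {S}
  apart i {ι} x with em {P = (ι , x) ∈ ruleVars (rule i)}
  ... | yes p = Injection.to (infinite ι) (pair i (toℕ (index p)))
  ... | no  _ = x

  apart-∈ : ∀ i {ι} {x : Var ι} → x ∈VarRule rule i →
            Σ[ p ∈ (ι , x) ∈ ruleVars (rule i) ]
              apart i x ≡ Injection.to (infinite ι) (pair i (toℕ (index p)))
  apart-∈ i {ι} {x} q with em {P = (ι , x) ∈ ruleVars (rule i)}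
  ... | yes p = p , refl
  ... | no ¬p = contradiction (∈-ruleVars (rule i) q) ¬p

  apart-injective : ∀ i j {ι} {x y : Var ι} → x ∈VarRule rule i → y ∈VarRule rule j →
                    apart i x ≡ apart j y → i ≡ j × x ≡ y
  apart-injective i j {ι} x∈ y∈ eq with apart-∈ i x∈ | apart-∈ j y∈
  ... | p , p≡ | q , q≡
    with pair-injective i j (Injection.injective (infinite ι) (trans (sym p≡) (trans eq q≡)))
  -- The list may contain repetitions, but a position determines its entry, so equal positions force
  -- equal variables.
  ... | refl , k≡l with index-injective (setoid _) p q (toℕ-injective k≡l)
  ... | refl = refl , refl

  glue : (ℕ → Subst {S}) → Subst {S}
  glue σ {ι} x with em {P = ∃[ i ] Σ[ y ∈ Var ι ] y ∈VarRule rule i × x ≡ apart i y}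
  ... | yes (i , y , _) = σ i y
  ... | no  _           = var x

  -- The preimage found by `glue` need not be presented as `i` and `x`, but injectivity across all
  -- rules forces it to coincide with them.
  glue-apart : ∀ (σ : ℕ → Subst) i {ι} {x : Var ι} → x ∈VarRule rule i →
               glue σ (apart i x) ≡ σ i x
  glue-apart σ i {ι} {x} x∈
    with em {P = ∃[ j ] Σ[ y ∈ Var ι ] y ∈VarRule rule j × apart i x ≡ apart j y}
  ... | no ¬p = contradiction (i , x , x∈ , refl) ¬p
  ... | yes (j , y , y∈ , eq) with apart-injective i j x∈ y∈ eq
  ... | refl , refl = refl

  glue-rename : ∀ (σ : ℕ → Subst {S}) i {μ} (t : Term S μ) →
                (∀ {ι} {x : Var ι} → x ∈Var t → x ∈VarRule rule i) →
                t [ asSubst (apart i) ] [ glue σ ] ≡ t [ σ i ]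
  glue-rename σ i t sub =
    trans ([]-rename t (apart i) (glue σ)) ([]-cong t (glue-apart σ i ∘ sub))

-- Chains from separate substitutions.

module _ (em : ExcludedMiddle 0ℓ) (L : LCTRS) where
  open LCTRS L renaming (setting to S)
  open Rule

  -- Reduces the construction of a chain to rules that share variables and carry one substitution
  -- each; renaming apart makes these substitutions compatible.
  chain : ∀ {κ} {P : Rule S κ → Set} (rule : ℕ → Rule S κ) → (∀ i → P (rule i)) →
          (σ : ℕ → Subst) → (∀ i → σ i Respects rule i) →
          (∀ i → Star (Step L) (rhs (rule i) [ σ i ]) (lhs (rule (suc i)) [ σ (suc i) ])) →
          (∀ i {ι} {s : Term S ι} → s ◁ lhs (rule i) [ σ i ] → TerminatingAt L s) →
          InfiniteChain L P
  chain rule rule∈P σ resp conn min = record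
    { rule      = rule
    ; rule∈P    = rule∈P
    ; δ         = apart em rule
    ; injective = λ i x∈ y∈ eq → proj₂ (apart-injective em rule i i x∈ y∈ eq)
    ; disjoint  = disjoint
    ; γ         = glue em rule σ
    ; respects  = λ i → respects-rename⁺ (apart em rule i) (rule i)
        (respects-cong (rule i) (sym ∘ glue-apart em rule σ i) (resp i))
    ; connected = λ i → subst₂ (Star (Step L)) (sym (rhs≡ i)) (sym (lhs≡ (suc i))) (conn i)
    ; minimal   = λ i p → min i (subst (_ ◁_) (lhs≡ i) p)
    }
    where
    lhs≡ : ∀ i → lhs (rule i) [ asSubst (apart em rule i) ] [ glue em rule σ ] ≡
                 lhs (rule i) [ σ i ]
    lhs≡ i = glue-rename em rule σ i (lhs (rule i)) inj₁

    rhs≡ : ∀ i → rhs (rule i) [ asSubst (apart em rule i) ] [ glue em rule σ ] ≡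
                 rhs (rule i) [ σ i ]
    rhs≡ i = glue-rename em rule σ i (rhs (rule i)) (inj₂ ∘ inj₁)

    disjoint : ∀ {i j} → i ≢ j → ∀ {ι} {x : Var ι} →
               x ∈VarRule rename (apart em rule i) (rule i) →
               ¬ (x ∈VarRule rename (apart em rule j) (rule j))
    disjoint {i} {j} i≢j p q
      with ∈VarRule-rename⁻ (apart em rule i) (rule i) p
         | ∈VarRule-rename⁻ (apart em rule j) (rule j) q
    ... | y , y∈ , refl | z , z∈ , eq = i≢j (proj₁ (apart-injective em rule i j y∈ z∈ eq))

-- Rewriting

module _ {L : LCTRS} where
  open LCTRS L renaming (setting to S)
  open Rule

  infix 4 _⟶_ _⇉_

  -- The shapes of `s` and `t` are given by equations rather than indices, so that a case split on a
  -- step never has to unify a term with a substitution instance.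
  data Root {κ} (s t : Term S κ) : Set where
    rule : {ρ : Rule S κ} → R ρ → (γ : Subst) → γ Respects ρ →
           s ≡ lhs ρ [ γ ] → t ≡ rhs ρ [ γ ] → Root s t
    calc : ∀ {δ} (f : TheorySym δ κ) (vs : All Val δ) (v : Val κ) →
           (Term S κ ∋ con (theory f) (All.map ⌞_⌟ vs)) ⇓ ⟦ v ⟧ᵥ →
           s ≡ con (theory f) (All.map ⌞_⌟ vs) → t ≡ ⌞ v ⌟ → Root s t

  -- An inductive presentation of Step.
  mutual
    data _⟶_ {κ} : Term S κ → Term S κ → Set where
      root : ∀ {s t} → Root s t → s ⟶ t
      arg  : ∀ {δ} {f : Sym S δ κ} {ts us} → ts ⇉ us → con f ts ⟶ con f us

    data _⇉_ : ∀ {δ} → All (Term S) δ → All (Term S) δ → Set where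
      here  : ∀ {κ δ} {t u : Term S κ} {ts : All (Term S) δ} → t ⟶ u → (t ∷ ts) ⇉ (u ∷ ts)
      there : ∀ {κ δ} {t : Term S κ} {ts us : All (Term S) δ} → ts ⇉ us → (t ∷ ts) ⇉ (t ∷ us)

  mutual
    ⟨⟩-⟶ : ∀ {ι κ} (C : Context ι κ) {s t : Term S ι} → s ⟶ t → C ⟨ s ⟩ ⟶ C ⟨ t ⟩
    ⟨⟩-⟶ □          p = p
    ⟨⟩-⟶ (con f Cs) p = arg (⟨⟩-⇉ Cs p)

    ⟨⟩-⇉ : ∀ {ι δ} (Cs : Contexts ι δ) {s t : Term S ι} → s ⟶ t → Cs ⟨ s ⟩* ⇉ Cs ⟨ t ⟩*
    ⟨⟩-⇉ (here C ts)  p = here (⟨⟩-⟶ C p)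
    ⟨⟩-⇉ (there t Cs) p = there (⟨⟩-⇉ Cs p)

  step⇒⟶ : ∀ {κ} {s t : Term S κ} → Step L s t → s ⟶ t
  step⇒⟶ (inj₁ (step C Rρ γ resp))  = ⟨⟩-⟶ C (root (rule Rρ γ resp refl refl))
  step⇒⟶ (inj₂ (step C f vs v f⇓v)) = ⟨⟩-⟶ C (root (calc f vs v f⇓v refl refl))

  private
    data Redex {κ} : Term S κ → Term S κ → Set where
      redex : ∀ {ι} (C : Context ι κ) {s t : Term S ι} → Root s t → Redex (C ⟨ s ⟩) (C ⟨ t ⟩)

    data Redex* {δ} : All (Term S) δ → All (Term S) δ → Set where
      redex : ∀ {ι} (Cs : Contexts ι δ) {s t : Term S ι} → Root s t → Redex* (Cs ⟨ s ⟩*) (Cs ⟨ t ⟩*)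

    mutual
      findRedex : ∀ {κ} {s t : Term S κ} → s ⟶ t → Redex s t
      findRedex (root r) = redex □ r
      findRedex (arg q) with findRedex* q
      ... | redex Cs r = redex (con _ Cs) r

      findRedex* : ∀ {δ} {ts us : All (Term S) δ} → ts ⇉ us → Redex* ts us
      findRedex* (here p) with findRedex p
      ... | redex C r = redex (here C _) r
      findRedex* (there q) with findRedex* q
      ... | redex Cs r = redex (there _ Cs) r

  ⟶⇒step : ∀ {κ} {s t : Term S κ} → s ⟶ t → Step L s t
  ⟶⇒step p with findRedex p
  ... | redex C (rule Rρ γ resp refl refl)  = inj₁ (step C Rρ γ resp)
  ... | redex C (calc f vs v f⇓v refl refl) = inj₂ (step C f vs v f⇓v)

  -- Termination as accessibility.

  SN : ∀ {κ} → Term S κ → Set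
  SN = Acc (flip _⟶_)

  SN* : ∀ {δ} → All (Term S) δ → Set
  SN* = Acc (flip _⇉_)

  SN⇒terminating : ∀ {κ} {t : Term S κ} → SN t → TerminatingAt L t
  SN⇒terminating sn (s , s0≡t , dec) = acc⇒¬sequence sn s (s0≡t , step⇒⟶ ∘ dec)

  terminating⇒SN : ExcludedMiddle 0ℓ → ∀ {κ} {t : Term S κ} → TerminatingAt L t → SN t
  terminating⇒SN em ter = decidable-stable em λ ¬sn →
    let s , s0≡t , dec = ¬acc⇒sequence em ¬sn in ter (s , s0≡t , ⟶⇒step ∘ dec)

  mutual
    -- Lifts a step through the surrounding context while remembering only the subterm relation, so
    -- growing contexts never need to be composed explicitly.
    ⊴-⟶ : ∀ {ι κ} {s s′ : Term S ι} {t : Term S κ} → s ⊴ t → s ⟶ s′ → ∃[ t′ ] t ⟶ t′ × s′ ⊴ t′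
    ⊴-⟶ self             p = _ , p , self
    ⊴-⟶ (strict (arg q)) p = let us , r , s⊴us = ⊴*-⇉ q p in _ , arg r , strict (arg s⊴us)

    ⊴*-⇉ : ∀ {ι δ} {s s′ : Term S ι} {ts : All (Term S) δ} → s ⊴* ts → s ⟶ s′ →
           ∃[ us ] ts ⇉ us × s′ ⊴* us
    ⊴*-⇉ (here q)  p = let u , r , s⊴u = ⊴-⟶ q p in _ , here r , here s⊴u
    ⊴*-⇉ (there q) p = let us , r , s⊴us = ⊴*-⇉ q p in _ , there r , there s⊴us

  SN-⊴ : ∀ {ι κ} {s : Term S ι} {t : Term S κ} → s ⊴ t → SN t → SN s
  SN-⊴ s⊴t (acc rs) = acc λ p → let _ , r , s′⊴t′ = ⊴-⟶ s⊴t p in SN-⊴ s′⊴t′ (rs r)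

  SN*-⊴* : ∀ {ι δ} {s : Term S ι} {ts : All (Term S) δ} → s ⊴* ts → SN* ts → SN s
  SN*-⊴* s⊴ts (acc rs) = acc λ p → let _ , r , s′⊴us = ⊴*-⇉ s⊴ts p in SN*-⊴* s′⊴us (rs r)

  SN*-∷ : ∀ {κ δ} {t : Term S κ} {ts : All (Term S) δ} → SN t → SN* ts → SN* (t ∷ ts)
  SN*-∷ (acc rs) (acc rs*) = acc λ where
    (here p)  → SN*-∷ (rs p) (acc rs*)
    (there q) → SN*-∷ (acc rs) (rs* q)

  SN*-args : ∀ {δ} (ts : All (Term S) δ) → (∀ {ι} {s : Term S ι} → s ⊴* ts → SN s) → SN* ts
  SN*-args []       sn = acc λ ()
  SN*-args (t ∷ ts) sn = SN*-∷ (sn (here self)) (SN*-args ts (sn ∘ there))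

  SN*-star : ∀ {δ} {ts us : All (Term S) δ} → Star _⇉_ ts us → SN* ts → SN* us
  SN*-star ε        sn       = sn
  SN*-star (q ◅ qs) (acc rs) = SN*-star qs (rs q)

  -- Variables, and likewise values below, are normal forms: only a logical term has such an
  -- instance, and left-hand sides are not logical.
  SN-var : ∀ {κ} {x : Var κ} → SN (var x)
  SN-var = acc λ where
    (root (rule {ρ} _ γ _ eq _)) → contradiction (var-[]⁻ (lhs ρ) eq) (lhs-nonlogical ρ)
    (root (calc _ _ _ _ () _))

  SN-value : ∀ {κ} {t : Term S κ} → IsValue t → SN t
  SN-value (v , refl) = acc λ where
    (root (rule {ρ} _ γ _ eq _)) →
      contradiction (value-[]⁻ (lhs ρ) (v , sym eq)) (lhs-nonlogical ρ)
    (root (calc _ _ _ _ () _))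
    (arg ())

  instance-head : ∀ {δ κ} {f : Sym S δ κ} {us} {γ : Subst} {l} →
                  ¬ Logical l → con f us ≡ l [ γ ] → _HeadOf_ L f l
  instance-head {l = var x}    nl _    = contradiction var nl
  instance-head {l = con g ls} _  refl = head

  -- Minimal non-terminating terms.

  module _ (em : ExcludedMiddle 0ℓ) where

    record RootReduction {δ κ} (f : Sym S δ κ) (ts : All (Term S) δ) : Set where
      field
        {us}    : All (Term S) δ
        args    : Star _⇉_ ts us
        {ρ}     : Rule S κ
        Rρ      : R ρ
        γ       : Subst
        resp    : γ Respects ρ
        matches : con f us ≡ lhs ρ [ γ ]
        ¬SN-rhs : ¬ SN (rhs ρ [ γ ])

    -- Follow non-terminating successors by induction on the termination of the arguments: steps in
    -- the arguments run out, so a root step comes. It is not a calculation, since its result would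
    -- be a terminating value.
    ¬SN⇒rootReduction : ∀ {δ κ} {f : Sym S δ κ} {ts} → SN* ts → ¬ SN (con f ts) →
                        RootReduction f ts
    ¬SN⇒rootReduction (acc rs) ¬sn with ¬acc⇒∃ em ¬sn
    ... | _ , root (rule Rρ γ resp eq refl) , ¬sn′ =
      record { args = ε ; Rρ = Rρ ; γ = γ ; resp = resp ; matches = eq ; ¬SN-rhs = ¬sn′ }
    ... | _ , root (calc _ _ v _ _ refl) , ¬sn′ = contradiction (SN-value (v , refl)) ¬sn′
    ... | _ , arg q , ¬sn′ =
      let r = ¬SN⇒rootReduction (rs q) ¬sn′ in
      record { RootReduction r ; args = q ◅ RootReduction.args r }

    rootReduction⇒defined : ∀ {δ κ} {f : Sym S δ κ} {ts} → RootReduction f ts → Defined L f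
    rootReduction⇒defined r = _ , ρ , Rρ , instance-head (lhs-nonlogical ρ) matches
      where open RootReduction r

    -- Minimality ranges over the subterms of `t` before instantiation, since dependency pairs are
    -- built from subterms of the right-hand side of a rule and not of its instance.
    Minimal : ∀ {κ} → Term S κ → (Subst {S}) → Set
    Minimal t γ = ¬ SN (t [ γ ]) × (∀ {κ} {q : Term S κ} → q ◁ t → SN (q [ γ ]))

    mutual
      -- The search is bottom-up: when a term is tested, all its strict subterms are already known
      -- to terminate under `γ`. The second alternative speaks of every subterm in order to carry
      -- this information upwards.
      findMinimal : ∀ {κ} (t : Term S κ) (γ : Subst) →
                    (∃[ ι ] Σ[ p ∈ Term S ι ] p ⊴ t × Minimal p γ) ⊎
                    (∀ {ι} {q : Term S ι} → q ⊴ t → SN (q [ γ ]))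
      findMinimal (var x) γ with em {P = SN (γ x)}
      ... | yes sn = inj₂ λ { self → sn }
      ... | no ¬sn = inj₁ (_ , var x , self , ¬sn , λ ())
      findMinimal (con f ts) γ with findMinimal* ts γ
      ... | inj₁ (_ , p , p⊴ts , min) = inj₁ (_ , p , strict (arg p⊴ts) , min)
      ... | inj₂ sn* with em {P = SN (con f ts [ γ ])}
      ...   | yes sn = inj₂ λ { self → sn ; (strict (arg q)) → sn* q }
      ...   | no ¬sn = inj₁ (_ , con f ts , self , ¬sn , λ { (arg q) → sn* q })

      findMinimal* : ∀ {δ} (ts : All (Term S) δ) (γ : Subst) →
                     (∃[ ι ] Σ[ p ∈ Term S ι ] p ⊴* ts × Minimal p γ) ⊎
                     (∀ {ι} {q : Term S ι} → q ⊴* ts → SN (q [ γ ]))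
      findMinimal* []       γ = inj₂ λ ()
      findMinimal* (t ∷ ts) γ with findMinimal t γ | findMinimal* ts γ
      ... | inj₁ (_ , p , p⊴t , min) | _ = inj₁ (_ , p , here p⊴t , min)
      ... | inj₂ _  | inj₁ (_ , p , p⊴ts , min) = inj₁ (_ , p , there p⊴ts , min)
      ... | inj₂ sn | inj₂ sn* = inj₂ λ { (here q) → sn q ; (there q) → sn* q }

    -- The root reduction is a function of the candidate, so the rule, substitution and reduced
    -- arguments chosen for it are the same at every later mention.
    record Candidate : Set where
      field
        {δ}  : List Sort
        {κ}  : Sort
        f    : Sym S δ κ
        ts   : All (Term S) δ
        SNts : SN* ts
        ¬SNt : ¬ SN (con f ts)

      reduction : RootReduction f ts
      reduction = ¬SN⇒rootReduction SNts ¬SNt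

      open RootReduction reduction public

      SNus : SN* us
      SNus = SN*-star args SNts

    minimal⇒candidate : ∀ {δ κ} (f : Sym S δ κ) (ts : All (Term S) δ) (γ : Subst) →
                        Minimal (con f ts) γ → Candidate
    minimal⇒candidate f ts γ (¬sn , sn) = record
      { f = f ; ts = ts [ γ ]* ; ¬SNt = ¬sn
      -- A subterm of an instantiated argument lies within the instance of some argument, which
      -- terminates by minimality.
      ; SNts = SN*-args (ts [ γ ]*) λ q →
          let _ , t , t⊴ts , s⊴t = []*-⊴*⁻ ts γ q in SN-⊴ s⊴t (sn (arg t⊴ts)) }

    -- A subterm p of r with pγ minimal non-terminating is not a variable, as γ maps the variables
    -- of r to values or to proper subterms of lγ, which terminate.
    record Next (c : Candidate) : Set where
      open Candidate c
      field
        {δ′ ι} : _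
        g      : Sym S δ′ ι
        ps     : All (Term S) δ′
        p⊴r    : con g ps ⊴ rhs ρ
        min    : Minimal (con g ps) γ

      target : Candidate
      target = minimal⇒candidate g ps γ min

    next : ∀ c → Next c
    next c = search (findMinimal (rhs ρ) γ)
      where
      open Candidate c

      SN-γ : ∀ {ι} {x : Var ι} → x ∈Var rhs ρ → SN (γ x)
      SN-γ {x = x} x∈r with em {P = x ∈Var lhs ρ}
      ... | no x∉l = SN-value (proj₁ resp (inj₂ (x∈r , x∉l)))
      ... | yes x∈l = SN*-⊴* (instance-var (lhs-nonlogical ρ) matches x∈l) SNus

      search : (∃[ ι ] Σ[ p ∈ Term S ι ] p ⊴ rhs ρ × Minimal p γ) ⊎
               (∀ {ι} {q : Term S ι} → q ⊴ rhs ρ → SN (q [ γ ])) → Next c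
      search (inj₂ sn)                                  = contradiction (sn self) ¬SN-rhs
      search (inj₁ (_ , var x , x∈r , ¬sn , _))         = contradiction (SN-γ x∈r) ¬sn
      search (inj₁ (_ , con g ps , p⊴r , min)) = record { g = g ; ps = ps ; p⊴r = p⊴r ; min = min }

    ¬SN⇒candidate : ∀ {κ} {t : Term S κ} → ¬ SN t → Candidate
    ¬SN⇒candidate {t = t} ¬sn with findMinimal t var
    -- Under the identity substitution, minimality is that of a subterm of `t` itself.
    ... | inj₂ sn                           = contradiction (subst SN ([]-var t) (sn self)) ¬sn
    ... | inj₁ (_ , var x , _ , ¬sn′ , _)   = contradiction SN-var ¬sn′
    ... | inj₁ (_ , con f ts , _ , min)     = minimal⇒candidate f ts var min

-- The extension by marked symbols

module _ {L : LCTRS} where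
  open LCTRS L renaming (setting to S)
  open Rule

  mutual
    -- Total on terms of an old sort: marked symbols have result sort `dpsort`, and symbols with an
    -- old result sort take only old arguments. Thus `embed` is a bijection onto these terms.
    unembed : ∀ {κ} → Term (setting♯ L) (just κ) → Term S κ
    unembed (var x)                       = var x
    unembed (con (term (old {δ} f)) ts)   = con (term f) (unembed* δ ts)
    unembed (con (theory (old {δ} f)) ts) = con (theory f) (unembed* δ ts)
    unembed (con (val v) [])              = ⌞ v ⌟

    unembed* : ∀ δ → All (Term (setting♯ L)) (map just δ) → All (Term S) δ
    unembed* []      []       = []
    unembed* (κ ∷ δ) (t ∷ ts) = unembed t ∷ unembed* δ ts

  mutual
    embed-unembed : ∀ {κ} (t : Term (setting♯ L) (just κ)) → embed L (unembed t) ≡ t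
    embed-unembed (var x)                       = refl
    embed-unembed (con (term (old {δ} f)) ts)   = cong (con (term (old f))) (embed*-unembed* δ ts)
    embed-unembed (con (theory (old {δ} f)) ts) = cong (con (theory (old f))) (embed*-unembed* δ ts)
    embed-unembed (con (val v) [])              = refl

    embed*-unembed* : ∀ δ (ts : All (Term (setting♯ L)) (map just δ)) →
                      embed* L (unembed* δ ts) ≡ ts
    embed*-unembed* []      []       = refl
    embed*-unembed* (κ ∷ δ) (t ∷ ts) = cong₂ _∷_ (embed-unembed t) (embed*-unembed* δ ts)

  mutual
    unembed-embed : ∀ {κ} (t : Term S κ) → unembed (embed L t) ≡ t
    unembed-embed (var x)             = refl
    unembed-embed (con (term f) ts)   = cong (con (term f)) (unembed*-embed* ts)
    unembed-embed (con (theory f) ts) = cong (con (theory f)) (unembed*-embed* ts)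
    unembed-embed (con (val v) [])    = refl

    unembed*-embed* : ∀ {δ} (ts : All (Term S) δ) → unembed* δ (embed* L ts) ≡ ts
    unembed*-embed* []       = refl
    unembed*-embed* (t ∷ ts) = cong₂ _∷_ (unembed-embed t) (unembed*-embed* ts)

  embedSubst : Subst {S} → Subst {setting♯ L}
  embedSubst γ {just κ}  x = embed L (γ x)
  embedSubst γ {nothing} x = var x

  unembedSubst : Subst {setting♯ L} → Subst {S}
  unembedSubst γ x = unembed (γ x)

  mutual
    embed-[] : ∀ {κ} (t : Term S κ) (γ : Subst {S}) →
               embed L (t [ γ ]) ≡ embed L t [ embedSubst γ ]
    embed-[] (var x)             γ = refl
    embed-[] (con (term f) ts)   γ = cong (con (term (old f))) (embed*-[]* ts γ)
    embed-[] (con (theory f) ts) γ = cong (con (theory (old f))) (embed*-[]* ts γ)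
    embed-[] (con (val v) [])    γ = refl

    embed*-[]* : ∀ {δ} (ts : All (Term S) δ) (γ : Subst {S}) →
                 embed* L (ts [ γ ]*) ≡ embed* L ts [ embedSubst γ ]*
    embed*-[]* []       γ = refl
    embed*-[]* (t ∷ ts) γ = cong₂ _∷_ (embed-[] t γ) (embed*-[]* ts γ)

  mutual
    unembed-[] : ∀ {κ} (t : Term S κ) (γ : Subst {setting♯ L}) →
                 unembed (embed L t [ γ ]) ≡ t [ unembedSubst γ ]
    unembed-[] (var x)             γ = refl
    unembed-[] (con (term f) ts)   γ = cong (con (term f)) (unembed*-[]* ts γ)
    unembed-[] (con (theory f) ts) γ = cong (con (theory f)) (unembed*-[]* ts γ)
    unembed-[] (con (val v) [])    γ = refl

    unembed*-[]* : ∀ {δ} (ts : All (Term S) δ) (γ : Subst {setting♯ L}) →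
                   unembed* δ (embed* L ts [ γ ]*) ≡ ts [ unembedSubst γ ]*
    unembed*-[]* []       γ = refl
    unembed*-[]* (t ∷ ts) γ = cong₂ _∷_ (unembed-[] t γ) (unembed*-[]* ts γ)

  embed-unembedSubst : ∀ {κ} (t : Term S κ) (γ : Subst {setting♯ L}) →
                       embed L (t [ unembedSubst γ ]) ≡ embed L t [ γ ]
  embed-unembedSubst t γ =
    trans (cong (embed L) (sym (unembed-[] t γ))) (embed-unembed (embed L t [ γ ]))

  mutual
    embed-⊴⁺ : ∀ {ι κ} {s : Term S ι} {t : Term S κ} → s ⊴ t → embed L s ⊴ embed L t
    embed-⊴⁺ self = self
    embed-⊴⁺ {t = con (term f) ts}   (strict (arg q)) = strict (arg (embed*-⊴*⁺ q))
    embed-⊴⁺ {t = con (theory f) ts} (strict (arg q)) = strict (arg (embed*-⊴*⁺ q))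
    embed-⊴⁺ {t = con (val v) []}    (strict (arg ()))

    embed*-⊴*⁺ : ∀ {ι δ} {s : Term S ι} {ts : All (Term S) δ} → s ⊴* ts → embed L s ⊴* embed* L ts
    embed*-⊴*⁺ (here q)  = here (embed-⊴⁺ q)
    embed*-⊴*⁺ (there q) = there (embed*-⊴*⁺ q)

  -- Every subterm of an embedded term has a sort of S, never dpsort.
  data Old (P : ∀ {ι} → Term S ι → Set) : ∀ {ι} → Term (setting♯ L) ι → Set where
    old : ∀ {ι} {s : Term (setting♯ L) (just ι)} → P (unembed s) → Old P s

  Old-map : {P Q : ∀ {ι} → Term S ι → Set} → (∀ {ι} {s : Term S ι} → P s → Q s) →
            ∀ {ι} {s : Term (setting♯ L) ι} → Old P s → Old Q s
  Old-map P⇒Q (old p) = old (P⇒Q p)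

  old⁻ : {P : ∀ {ι} → Term S ι → Set} → ∀ {ι} {s : Term (setting♯ L) (just ι)} →
         Old P s → P (unembed s)
  old⁻ (old p) = p

  mutual
    embed-⊴⁻ : ∀ {ι κ} {s : Term (setting♯ L) ι} (t : Term S κ) → s ⊴ embed L t → Old (_⊴ t) s
    embed-⊴⁻ t self = old (subst (_⊴ t) (sym (unembed-embed t)) self)
    embed-⊴⁻ (con (term f) ts)   (strict (arg q)) = Old-map (strict ∘ arg) (embed*-⊴*⁻ ts q)
    embed-⊴⁻ (con (theory f) ts) (strict (arg q)) = Old-map (strict ∘ arg) (embed*-⊴*⁻ ts q)
    embed-⊴⁻ (con (val v) [])    (strict (arg ()))

    embed*-⊴*⁻ : ∀ {ι δ} {s : Term (setting♯ L) ι} (ts : All (Term S) δ) →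
                 s ⊴* embed* L ts → Old (_⊴* ts) s
    embed*-⊴*⁻ (t ∷ ts) (here q)  = Old-map here (embed-⊴⁻ t q)
    embed*-⊴*⁻ (t ∷ ts) (there q) = Old-map there (embed*-⊴*⁻ ts q)

  isValue-embed : ∀ {κ} {t : Term S κ} → IsValue t → IsValue (embed L t)
  isValue-embed (v , refl) = v , refl

  isValue-embedSubst : {γ : Subst} {P : ∀ {ι} → Term S ι → Set} →
                       (∀ {ι} {x : Var ι} → P (var x) → IsValue (γ x)) →
                       ∀ {ι} {x : Var♯ L ι} → Old P {ι} (var x) → IsValue {κ = ι} (embedSubst γ x)
  isValue-embedSubst values (old p) = isValue-embed (values p)

  isValue-unembed : ∀ {κ} {t : Term (setting♯ L) (just κ)} → IsValue t → IsValue (unembed t)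
  isValue-unembed (v , refl) = v , refl

  mutual
    ⇓-embed : ∀ {κ} {t : Term S κ} {a} → t ⇓ a → embed L t ⇓ a
    ⇓-embed (theory p) with ⇓*-embed p
    ... | _ , q , refl = theory q
    ⇓-embed val = val

    -- The extended interpretation applies `J f` after `map⁻`, so the evaluated arguments are
    -- required to agree with `as` only after `map⁻`.
    ⇓*-embed : ∀ {δ} {ts : All (Term S) δ} {as} → ts ⇓* as →
               ∃[ as′ ] embed* L ts ⇓* as′ × map⁻ as′ ≡ as
    ⇓*-embed []       = [] , [] , refl
    ⇓*-embed (p ∷ ps) with ⇓*-embed ps
    ... | as′ , qs , refl = _ , ⇓-embed p ∷ qs , refl

  mutual
    ⇓-unembed : ∀ {κ} {t : Term (setting♯ L) (just κ)} {a} → t ⇓ a → unembed t ⇓ a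
    ⇓-unembed (theory {f = old {δ} f} p) = theory (⇓*-unembed δ p)
    ⇓-unembed val                        = val

    ⇓*-unembed : ∀ δ {ts : All (Term (setting♯ L)) (map just δ)} {as} → ts ⇓* as →
                 unembed* δ ts ⇓* map⁻ as
    ⇓*-unembed []      []       = []
    ⇓*-unembed (κ ∷ δ) (p ∷ ps) = ⇓-unembed p ∷ ⇓*-unembed δ ps

  valid-embed : ∀ {φ : Term S bool} → Valid φ → Valid (embed L φ)
  valid-embed {φ} (logical , valid) = logical-embed⁺ L logical , λ γ values →
    subst (_⇓ ⊤ᴵ) (embed-unembedSubst φ γ)
      (⇓-embed (valid (unembedSubst γ) λ x∈φ → isValue-unembed (values (embed-⊴⁺ x∈φ))))

  valid-unembed : ∀ {φ : Term S bool} → Valid (embed L φ) → Valid φ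
  valid-unembed {φ} (logical , valid) = logical-embed⁻ L φ logical , λ γ values →
    subst (_⇓ ⊤ᴵ) (unembed-embed (φ [ γ ])) (⇓-unembed (subst (_⇓ ⊤ᴵ) (sym (embed-[] φ γ))
      (valid (embedSubst γ) λ x∈φ → isValue-embedSubst values (embed-⊴⁻ φ x∈φ))))

  valid-unembedSubst : ∀ (φ : Term S bool) {γ : Subst {setting♯ L}} →
                       Valid (embed L φ [ γ ]) → Valid (φ [ unembedSubst γ ])
  valid-unembedSubst φ {γ} valid = valid-unembed (subst Valid (sym (embed-unembedSubst φ γ)) valid)

  respects-unembed : ∀ {κ} {ρ : Rule S κ} {γ : Subst} → γ Respects embedRule L ρ →
                     unembedSubst γ Respects ρ
  respects-unembed {ρ = ρ} {γ} (values , valid) = values′ , valid-unembedSubst (constraint ρ) valid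
    where
    values′ : ∀ {ι} {x : Var ι} → x ∈LVar ρ → IsValue (unembedSubst γ x)
    values′ (inj₁ x∈φ)         = isValue-unembed (values (inj₁ (embed-⊴⁺ x∈φ)))
    values′ (inj₂ (x∈r , x∉l)) =
      isValue-unembed (values (inj₂ (embed-⊴⁺ x∈r , x∉l ∘ old⁻ ∘ embed-⊴⁻ (lhs ρ))))

  unembed*-values : ∀ δ (vs : All (Val♯ L) (map just δ)) →
                    unembed* δ (All.map (λ {κ} → ⌞_⌟ {setting♯ L} {κ}) vs) ≡ All.map ⌞_⌟ (map⁻ vs)
  unembed*-values []      []       = refl
  unembed*-values (κ ∷ δ) (v ∷ vs) = cong (⌞ v ⌟ ∷_) (unembed*-values δ vs)

  root-unembed : ∀ {κ} {s t : Term (setting♯ L) (just κ)} →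
                 Root {lctrs♯ L} s t → Root {L} (unembed s) (unembed t)
  root-unembed (rule (old {ρ = ρ} Rρ) γ resp refl refl) =
    rule Rρ (unembedSubst γ) (respects-unembed {ρ = ρ} resp)
      (unembed-[] (lhs ρ) γ) (unembed-[] (rhs ρ) γ)
  root-unembed (calc (old {δ} f) vs v f⇓v refl refl) =
    calc f (map⁻ vs) v
      (subst (λ us → (Term S _ ∋ con (theory f) us) ⇓ ⟦ v ⟧ᵥ)
        (unembed*-values δ vs) (⇓-unembed f⇓v))
      (cong (con (theory f)) (unembed*-values δ vs)) refl

  mutual
    ⟶-unembed : ∀ {κ} {s t : Term (setting♯ L) (just κ)} →
                _⟶_ {lctrs♯ L} s t → _⟶_ {L} (unembed s) (unembed t)
    ⟶-unembed (root r)                   = root (root-unembed r)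
    ⟶-unembed (arg {f = term (old {δ} f)} q)   = arg (⇉-unembed δ q)
    ⟶-unembed (arg {f = theory (old {δ} f)} q) = arg (⇉-unembed δ q)

    ⇉-unembed : ∀ δ {ts us : All (Term (setting♯ L)) (map just δ)} →
                _⇉_ {lctrs♯ L} ts us → _⇉_ {L} (unembed* δ ts) (unembed* δ us)
    ⇉-unembed (κ ∷ δ) (here p)  = here (⟶-unembed p)
    ⇉-unembed (κ ∷ δ) (there q) = there (⇉-unembed δ q)

  -- Every step of the extended system on a term of an old sort is the image of an original step, so
  -- the extension adds no reductions there.
  SN-unembed⁻ : ∀ {κ} {t : Term (setting♯ L) (just κ)} → SN {L} (unembed t) → SN {lctrs♯ L} t
  SN-unembed⁻ (acc rs) = acc λ p → SN-unembed⁻ (rs (⟶-unembed p))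

  -- The inclusions place `LVar` of `ρ♯` inside that of `ρ`. An arbitrary `ρ♯` covers both embedded
  -- rules and dependency pairs, whose right-hand side comes from a mere subterm.
  respects-embed : ∀ {κ κ′} {ρ : Rule S κ} {γ : Subst} → γ Respects ρ →
                   (ρ♯ : Rule (setting♯ L) κ′) → embed L (constraint ρ) ≡ constraint ρ♯ →
                   (∀ {ι} {x : Var ι} → x ∈Var lhs ρ → _∈Var_ {ι = just ι} x (lhs ρ♯)) →
                   (∀ {ι} {x : Var♯ L ι} → _∈Var_ {ι = ι} x (rhs ρ♯) → Old (_⊴ rhs ρ) {ι} (var x)) →
                   embedSubst γ Respects ρ♯
  respects-embed {ρ = ρ} {γ} (values , valid) ρ♯ refl l⊆l♯ r♯⊆r =
    values′ , subst Valid (embed-[] (constraint ρ) γ) (valid-embed valid)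
    where
    values′ : ∀ {ι} {x : Var♯ L ι} → _∈LVar_ {ι = ι} x ρ♯ → IsValue {κ = ι} (embedSubst γ x)
    values′ (inj₁ x∈φ) = isValue-embedSubst (values ∘ inj₁) (embed-⊴⁻ (constraint ρ) x∈φ)
    values′ (inj₂ (x∈r , x∉l)) with r♯⊆r x∈r
    ... | old q = isValue-embed (values (inj₂ (q , x∉l ∘ l⊆l♯)))

  embed*-values : ∀ {δ} (vs : All Val δ) →
                  embed* L (All.map ⌞_⌟ vs) ≡ All.map (λ {κ} → ⌞_⌟ {setting♯ L} {κ}) (map⁺ vs)
  embed*-values []       = refl
  embed*-values (v ∷ vs) = cong (⌞ v ⌟ ∷_) (embed*-values vs)

  root-embed : ∀ {κ} {s t : Term S κ} → Root {L} s t → Root {lctrs♯ L} (embed L s) (embed L t)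
  root-embed (rule {ρ} Rρ γ resp refl refl) =
    rule (old Rρ) (embedSubst γ)
      (respects-embed {ρ = ρ} resp (embedRule L ρ) refl embed-⊴⁺ (embed-⊴⁻ (rhs ρ)))
      (embed-[] (lhs ρ) γ) (embed-[] (rhs ρ) γ)
  root-embed (calc f vs v f⇓v refl refl) =
    calc (old f) (map⁺ vs) v
      (subst (λ us → (Term (setting♯ L) _ ∋ con (theory (old f)) us) ⇓ ⟦ v ⟧ᵥ)
        (embed*-values vs) (⇓-embed f⇓v))
      (cong (con (theory (old f))) (embed*-values vs)) refl

  mutual
    ⟶-embed : ∀ {κ} {s t : Term S κ} → _⟶_ {L} s t → _⟶_ {lctrs♯ L} (embed L s) (embed L t)
    ⟶-embed (root r)             = root (root-embed r)
    ⟶-embed (arg {f = term f} q)   = arg (⇉-embed q)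
    ⟶-embed (arg {f = theory f} q) = arg (⇉-embed q)

    ⇉-embed : ∀ {δ} {ts us : All (Term S) δ} →
              _⇉_ {L} ts us → _⇉_ {lctrs♯ L} (embed* L ts) (embed* L us)
    ⇉-embed (here p)  = here (⟶-embed p)
    ⇉-embed (there q) = there (⇉-embed q)

  -- The sort `dpsort` hides the result sort of the marked symbol, so the sort is returned with the
  -- term; variables of sort `dpsort` carry no mark to remove.
  unsharp : Term (setting♯ L) nothing → Maybe (∃[ κ ] Term S κ)
  unsharp (var x)                    = nothing
  unsharp (con (term (_♯ {δ} f _)) ts) = just (_ , con f (unembed* δ ts))

  unsharp-sharp : ∀ {κ} (t : Term S κ) (d : RootDefined L t) (γ : Subst) →
                  unsharp (sharp L t d [ γ ]) ≡ just (κ , t [ unembedSubst γ ])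
  unsharp-sharp (con f ts) d γ = cong (λ us → just (_ , con f us)) (unembed*-[]* ts γ)

  -- No rule and no calculation has sort `dpsort`, so the marked root persists and every step takes
  -- place in an argument.
  unsharp-star : ∀ {s s′ κ} {t : Term S κ} → unsharp s ≡ just (κ , t) →
                 Star (Step (lctrs♯ L)) s s′ →
                 ∃[ t′ ] unsharp s′ ≡ just (κ , t′) × Star (_⟶_ {L}) t t′
  unsharp-star eq ε = _ , eq , ε
  unsharp-star eq (st ◅ sts) with step⇒⟶ st
  ... | root (rule () _ _ _ _)
  ... | root (calc () _ _ _ _ _)
  unsharp-star refl (st ◅ sts) | arg {f = term (_♯ {δ} f _)} q =
    let _ , eq , ps = unsharp-star refl sts in _ , eq , arg (⇉-unembed δ q) ◅ ps

  -- Once the head of `l` is identified with `f`, irrelevance of the definedness proofs makes the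
  -- two marked symbols equal, and only the arguments have to be rewritten.
  sharp-star : ∀ {δ κ κ′} {f : Sym S δ κ} {ps us} {γ γ′ : Subst} .(d : Defined L f)
               (l : Term S κ′) .(d′ : RootDefined L l) →
               _≡_ {A = ∃[ κ ] Term S κ} (κ , con f us) (κ′ , l [ γ′ ]) →
               Star (_⇉_ {L}) (ps [ γ ]*) us →
               Star (Step (lctrs♯ L)) (sharp L (con f ps) d [ embedSubst γ ])
                                      (sharp L l d′ [ embedSubst γ′ ])
  sharp-star {f = f} {ps} {γ = γ} {γ′} d (con g ls) d′ refl qs =
    subst₂ (λ ts us → Star _ (con (term ((f ♯) d)) ts) (con (term ((f ♯) d)) us))
      (embed*-[]* ps γ) (embed*-[]* ls γ′)
      (gmap (λ ts → con (term ((f ♯) d)) (embed* L ts)) (λ q → ⟶⇒step (arg (⇉-embed q))) qs)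

  sharp-◁ : ∀ {δ κ} {f : Sym S δ κ} {us} {γ : Subst} (l : Term S κ) .(d : RootDefined L l) →
            con f us ≡ l [ γ ] → ∀ {ι} {s : Term (setting♯ L) ι} →
            s ◁ sharp L l d [ embedSubst γ ] → Old (_⊴* us) s
  sharp-◁ {γ = γ} (con g ls) d refl (arg q) =
    embed*-⊴*⁻ (ls [ γ ]*) (subst (_ ⊴*_) (sym (embed*-[]* ls γ)) q)

  ∈Var-sharp⁺ : ∀ {ι κ} {x : Var ι} (t : Term S κ) .(d : RootDefined L t) →
                x ∈Var t → _∈Var_ {ι = just ι} x (sharp L t d)
  ∈Var-sharp⁺ (con f ts) d (strict (arg q)) = strict (arg (embed*-⊴*⁺ q))

  ∈Var-sharp⁻ : ∀ {ι κ} {x : Var♯ L ι} (t : Term S κ) .(d : RootDefined L t) →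
                _∈Var_ {ι = ι} x (sharp L t d) → Old (_⊴ t) {ι} (var x)
  ∈Var-sharp⁻ (con f ts) d (strict (arg q)) = Old-map (strict ∘ arg) (embed*-⊴*⁻ ts q)

-- The two directions of the equivalence.

module _ (em : ExcludedMiddle 0ℓ) (L : LCTRS) (fresh : FreshVariablesHaveValues L) where
  open LCTRS L renaming (setting to S)
  open Rule

  -- The terms `l` and `p` are determined by `γ`, whereas `r` is left open because it depends on the
  -- modified substitution.
  record Reduct (ρ♯ : Rule (setting♯ L) nothing) (γ : Subst {setting♯ L}) : Set where
    field
      {κ ι} : Sort
      {l r} : Term S κ
      {p}   : Term S ι
      lhs≡  : unsharp (lhs ρ♯ [ γ ]) ≡ just (κ , l)
      rhs≡  : unsharp (rhs ρ♯ [ γ ]) ≡ just (ι , p)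
      l⟶r   : _⟶_ {L} l r
      p⊴r   : p ⊴ r

  -- γ need not map the variables of r that occur neither in l nor in p nor in φ to values, so
  -- it is changed there before the rule is applied.
  reduct : ∀ {ρ♯} {γ : Subst {setting♯ L}} → DP L ρ♯ → γ Respects ρ♯ → Reduct ρ♯ γ
  reduct {γ = γ} (dp {ρ = ρ} Rρ {p = p} p⊴r d) (values , valid) = record
    { lhs≡ = unsharp-sharp (lhs ρ) (lhs-defined L Rρ) γ
    ; rhs≡ = unsharp-sharp p d γ
    ; l⟶r  = root (rule Rρ σ respects (sym ([]-cong (lhs ρ) σ-lhs)) refl)
    ; p⊴r  = subst (_⊴ rhs ρ [ σ ]) ([]-cong p σ-p) ([]-⊴⁺ σ p⊴r)
    }
    where
    γ♭ : Subst
    γ♭ = unembedSubst γ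

    Unassigned : ∀ {ι} → Var ι → Set
    Unassigned x = x ∈Var rhs ρ × ¬ (x ∈Var lhs ρ) × ¬ IsValue (γ♭ x)

    σ : Subst
    σ x with em {P = Unassigned x}
    ... | yes (x∈r , x∉l , _) = ⌞ fresh Rρ x∈r x∉l ⌟
    ... | no _                = γ♭ x

    σ-assigned : ∀ {ι} {x : Var ι} → ¬ Unassigned x → σ x ≡ γ♭ x
    σ-assigned {x = x} ¬u with em {P = Unassigned x}
    ... | yes u = contradiction u ¬u
    ... | no _  = refl

    σ-lhs : ∀ {ι} {x : Var ι} → x ∈Var lhs ρ → σ x ≡ γ♭ x
    σ-lhs x∈l = σ-assigned λ (_ , x∉l , _) → x∉l x∈l

    φ-value : ∀ {ι} {x : Var ι} → x ∈Var constraint ρ → IsValue (γ♭ x)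
    φ-value x∈φ = isValue-unembed (values (inj₁ (embed-⊴⁺ x∈φ)))

    σ-φ : ∀ {ι} {x : Var ι} → x ∈Var constraint ρ → σ x ≡ γ♭ x
    σ-φ x∈φ = σ-assigned λ (_ , _ , ¬v) → ¬v (φ-value x∈φ)

    σ-p : ∀ {ι} {x : Var ι} → x ∈Var p → σ x ≡ γ♭ x
    -- A variable of `p` outside the left-hand side belongs to `LVar` of the dependency pair, so `γ`
    -- already maps it to a value.
    σ-p x∈p = σ-assigned λ (_ , x∉l , ¬v) → ¬v (isValue-unembed (values (inj₂
      (∈Var-sharp⁺ p d x∈p , x∉l ∘ old⁻ ∘ ∈Var-sharp⁻ (lhs ρ) (lhs-defined L Rρ)))))

    σ-value : ∀ {ι} {x : Var ι} → x ∈LVar ρ → IsValue (σ x)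
    σ-value (inj₁ x∈φ) = subst IsValue (sym (σ-φ x∈φ)) (φ-value x∈φ)
    σ-value {x = x} (inj₂ (x∈r , x∉l)) with em {P = Unassigned x}
    ... | yes _ = _ , refl
    ... | no ¬u = decidable-stable em λ ¬v → ¬u (x∈r , x∉l , ¬v)

    respects : σ Respects ρ
    respects = σ-value , subst Valid (sym ([]-cong (constraint ρ) σ-φ))
      (valid-unembedSubst (constraint ρ) valid)

  terminating⇒chainFree : Terminating L → ChainFree (lctrs♯ L) (DP L)
  terminating⇒chainFree terminating c = ¬SN 0 self ε refl (terminating⇒SN em (terminating _))
    where
    open InfiniteChain c renaming (rule to rules)

    σ : ℕ → Subst
    σ i {ι} x = γ (δ i {ι} x)

    renamed : ∀ i {κ} (t : Term (setting♯ L) κ) → t [ asSubst (λ {ι} → δ i {ι}) ] [ γ ] ≡ t [ σ i ]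
    renamed i t = []-rename t (λ {ι} → δ i {ι}) γ

    reducts : ∀ i → Reduct (rules i) (σ i)
    reducts i = reduct (rule∈P i) (respects-rename⁻ (δ i) (rules i) (injective i) (respects i))

    module D i = Reduct (reducts i)

    -- Consecutive pairs meet at sort `dpsort`, so the agreement of the original sorts is part of
    -- the conclusion.
    connected′ : ∀ i → ∃[ t ] (D.ι i , t) ≡ (D.κ (suc i) , D.l (suc i)) × Star (_⟶_ {L}) (D.p i) t
    connected′ i =
      let t , eq , ps = unsharp-star (trans (cong unsharp (renamed i (rhs (rules i)))) (D.rhs≡ i))
                                     (connected i)
          eq′ = trans (cong unsharp (renamed (suc i) (lhs (rules (suc i))))) (D.lhs≡ (suc i))
      in t , just-injective (trans (sym eq) eq′) , ps

    -- Induction on the accessibility of `t`, the whole term with its accumulated context, while `s`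
    -- is the part that follows the chain. Passing to the next pair costs one step of `t`, namely
    -- the rule step, so the induction also decreases when the connecting reduction is empty.
    ¬SN : ∀ i {κ ι} {s u : Term S ι} {t : Term S κ} → s ⊴ t → Star (_⟶_ {L}) s u →
          (ι , u) ≡ (D.κ i , D.l i) → ¬ SN {L} t
    ¬SN i s⊴t (q ◅ qs) eq   (acc rs) = let _ , r , s′⊴t′ = ⊴-⟶ s⊴t q in ¬SN i s′⊴t′ qs eq (rs r)
    ¬SN i s⊴t ε        refl (acc rs) =
      let _ , r , r⊴t′ = ⊴-⟶ s⊴t (D.l⟶r i)
          _ , eq , qs  = connected′ i
      in ¬SN (suc i) (⊴-trans (D.p⊴r i) r⊴t′) qs eq (rs r)

  chainFree⇒terminating : ChainFree (lctrs♯ L) (DP L) → Terminating L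
  chainFree⇒terminating chainFree t = SN⇒terminating (decidable-stable em λ ¬sn →
    chainFree (chain em (lctrs♯ L) (λ i → proj₁ (pairs ¬sn i)) (λ i → proj₂ (pairs ¬sn i))
      (λ i → embedSubst (C.γ ¬sn i)) (respects ¬sn) (connected ¬sn) (minimal ¬sn)))
    where
    module _ (¬sn : ¬ SN {L} t) where
      candidates : ℕ → Candidate {L} em
      candidates zero    = ¬SN⇒candidate em ¬sn
      candidates (suc i) = Next.target (next em (candidates i))

      module C i = Candidate (candidates i)
      module N i = Next (next em (candidates i))

      -- The right-hand side of pair `i` is headed by the root symbol of candidate `suc i`, whose
      -- own root reduction supplies a defining rule.
      defined : ∀ i → Defined L (N.g i)
      defined i = rootReduction⇒defined em (C.reduction (suc i))

      pairs : ∀ i → ∃[ ρ♯ ] DP L ρ♯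
      pairs i = _ , dp (C.Rρ i) (N.p⊴r i) (defined i)

      respects : ∀ i → embedSubst (C.γ i) Respects proj₁ (pairs i)
      respects i = respects-embed {ρ = C.ρ i} (C.resp i) (proj₁ (pairs i)) refl
        (∈Var-sharp⁺ (lhs (C.ρ i)) (lhs-defined L (C.Rρ i)))
        (Old-map (λ x∈p → ⊴-trans x∈p (N.p⊴r i)) ∘ ∈Var-sharp⁻ (con (N.g i) (N.ps i)) (defined i))

      connected : ∀ i → Star (Step (lctrs♯ L))
                            (rhs (proj₁ (pairs i)) [ embedSubst (C.γ i) ])
                            (lhs (proj₁ (pairs (suc i))) [ embedSubst (C.γ (suc i)) ])
      -- The connecting reduction is the argument reduction of candidate `suc i` that precedes its
      -- root step.
      connected i = sharp-star {γ = C.γ i} {γ′ = C.γ (suc i)} (defined i) (lhs (C.ρ (suc i)))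
        (lhs-defined L (C.Rρ (suc i))) (cong (_ ,_) (C.matches (suc i))) (C.args (suc i))

      minimal : ∀ i {ι} {s : Term (setting♯ L) ι} →
                s ◁ lhs (proj₁ (pairs i)) [ embedSubst (C.γ i) ] → TerminatingAt (lctrs♯ L) s
      -- Strict subterms of the marked instance lie in the arguments reached just before the root
      -- step; these terminate because the original arguments do.
      minimal i p with sharp-◁ {γ = C.γ i} (lhs (C.ρ i)) (lhs-defined L (C.Rρ i)) (C.matches i) p
      ... | old q = SN⇒terminating (SN-unembed⁻ (SN*-⊴* q (C.SNus i)))

theorem3 : ExcludedMiddle 0ℓ →
    (L : LCTRS) → FreshVariablesHaveValues L →
    Terminating L ⇔ ChainFree (lctrs♯ L) (DP L)
theorem3 em L fresh = mk⇔ (terminating⇒chainFree em L fresh) (chainFree⇒terminating em L fresh)
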